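{- Let $G$ and $H$ be finite simple connected graphs, neither of which is a complete graph. Then $tn(G\boxtimes H)=2$ if and only if there exist two different non-adjacent vertices $(x_1,y_1),(x_2,y_2)\in V(G\boxtimes H)$ such that (1) for any $(x,y)\in N((x_1,y_1))$, $N[(x,y)]\nsubseteq N[(x_1,y_1)]$, and (2) for any $(x,y)\in N((x_2,y_2))$, $N[(x,y)]\nsubseteq N[(x_2,y_2)]$.
   Context: $N(v)$ denotes the open neighborhood and $N[v]=N(v)\cup\{v\}$ the closed neighborhood of a vertex $v$ (here in $G\boxtimes H$). The strong product $G\boxtimes H$ has vertex set $V(G)\times V(H)$; $(g_1,h_1)$ and $(g_2,h_2)$ are adjacent iff ($g_1g_2\in E(G)$ and $h_1=h_2$) or ($g_1=g_2$ and $h_1h_2\in E(H)$) or ($g_1g_2\in E(G)$ and $h_1h_2\in E(H)$). For two different non-adjacent vertices $u,v$ of a graph $F$, a tolled walk between $u$ and $v$ is a sequence of vertices $u,w_1,\dots,w_k,v$ with $k\ge 1$ such that consecutive vertices of $w_1,\dots,w_k$ are adjacent, $uw_i\in E(F)$ if and only if $i=1$, and $vw_i\in E(F)$ if and only if $i=k$. If $uv\in E(F)$, the only tolled walk between $u$ and $v$ is $u,v$; the only tolled walk from $v$ to itself is the single vertex $v$. The toll interval $T_F(u,v)$ is the set of all vertices of $F$ lying on some tolled walk between $u$ and $v$. For $S\subseteq V(F)$ the toll closure is $T_F[S]=\bigcup_{u,v\in S}T_F(u,v)$. $S$ is a toll set of $F$ if $T_F[S]=V(F)$, and the toll number $tn(F)$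 is the minimum size of a toll set of $F$. -}

module Defs where

open import Data.Fin.Base using (Fin; zero; suc; inject₁; fromℕ)
open import Data.Fin.Properties using (inj⇒≟; *↔×)
open import Data.List.Base using (List; []; _∷_; [_]; _++_; length; tabulate)
open import Data.List.Membership.Propositional using (_∈_)
open import Data.List.Relation.Unary.Unique.Propositional using (Unique)
open import Data.Nat.Base using (ℕ; suc; _*_; _≤_)
open import Data.Product.Base using (Σ-syntax; ∃-syntax; ∃₂; _×_; _,_)
open import Data.Product.Function.NonDependent.Propositional using (_×-↔_)
open import Data.Sum.Base using (_⊎_; inj₁; inj₂)
open import Data.Vec.Functional using (Vector)
open import Function.Bundles using (_↔_; _⇔_)
open import Function.Construct.Composition using (_↔-∘_)
open import Function.Construct.Symmetry using (↔-sym)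
open import Function.Properties.Inverse using (↔⇒↣)
open import Level using (0ℓ)
open import Relation.Binary.Construct.Closure.ReflexiveTransitive using (Star)
open import Relation.Binary.Core using (Rel)
open import Relation.Binary.Definitions using (Decidable; DecidableEquality; Symmetric)
open import Relation.Binary.PropositionalEquality.Core using (_≡_; _≢_; refl; sym)
open import Relation.Nullary using (¬_; _×-dec_; _⊎-dec_)
open import Relation.Unary using (Pred)

-- A finite simple graph. Vertices form an arbitrary finite type, so that the
-- vertex type of a product graph is literally a product type.  Decidability of
-- adjacency makes the edge set a genuine (detachable) finite set of pairs.
record Graph : Set₁ where
  infix 4 _~_
  field
    V       : Set
    order   : ℕ
    finite  : V ↔ Fin order
    _~_     : Rel V 0ℓ
    _~?_    : Decidable _~_
    ~-sym   : Symmetric _~_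
    ~-irr   : ∀ {v} → ¬ (v ~ v)

  _≟_ : DecidableEquality V
  _≟_ = inj⇒≟ (↔⇒↣ finite)

  N : V → Pred V 0ℓ
  N v w = v ~ w

  N[_] : V → Pred V 0ℓ
  N[ v ] w = w ≡ v ⊎ v ~ w

Connected : Graph → Set
Connected F = ∀ u v → Star _~_ u v
  where open Graph F

Complete : Graph → Set
Complete F = ∀ u v → u ≢ v → u ~ v
  where open Graph F

infixr 7 _⊠_

_⊠_ : Graph → Graph → Graph
G ⊠ H = record
  { V      = G.V × H.V
  ; order  = G.order * H.order
  ; finite = ↔-sym *↔× ↔-∘ (G.finite ×-↔ H.finite)
  ; _~_    = adj
  ; _~?_   = λ (g₁ , h₁) (g₂ , h₂) →
               ((g₁ G.~? g₂) ×-dec (h₁ H.≟ h₂)) ⊎-dec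
               (((g₁ G.≟ g₂) ×-dec (h₁ H.~? h₂)) ⊎-dec
                ((g₁ G.~? g₂) ×-dec (h₁ H.~? h₂)))
  ; ~-sym  = adj-sym
  ; ~-irr  = λ { (inj₁ (p , _))        → G.~-irr p
               ; (inj₂ (inj₁ (_ , q))) → H.~-irr q
               ; (inj₂ (inj₂ (p , _))) → G.~-irr p }
  }
  where
  module G = Graph G
  module H = Graph H

  adj : Rel (G.V × H.V) 0ℓ
  adj (g₁ , h₁) (g₂ , h₂) =
    (g₁ G.~ g₂ × h₁ ≡ h₂) ⊎ (g₁ ≡ g₂ × h₁ H.~ h₂) ⊎ (g₁ G.~ g₂ × h₁ H.~ h₂)

  adj-sym : Symmetric adj
  adj-sym (inj₁ (p , q))        = inj₁ (G.~-sym p , sym q)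
  adj-sym (inj₂ (inj₁ (p , q))) = inj₂ (inj₁ (sym p , H.~-sym q))
  adj-sym (inj₂ (inj₂ (p , q))) = inj₂ (inj₂ (G.~-sym p , H.~-sym q))

module _ (F : Graph) where
  open Graph F

  -- In the nonadjacent case the inner vertices w₁, …, wₖ with k = suc m are
  -- indexed from zero, so w₁ is `w zero` and wₖ is `w (fromℕ m)`.
  data TolledWalk : V → V → Set where
    trivial : ∀ v → TolledWalk v v
    edge    : ∀ {u v} → u ~ v → TolledWalk u v
    walk    : ∀ {u v} → u ≢ v → ¬ (u ~ v) →
              ∀ {m} (w : Vector V (suc m)) →
              (∀ (i : Fin m) → w (inject₁ i) ~ w (suc i)) →
              (∀ i → u ~ w i ⇔ i ≡ zero) →
              (∀ i → v ~ w i ⇔ i ≡ fromℕ m) →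
              TolledWalk u v

  vertices : ∀ {u v} → TolledWalk u v → List V
  vertices         (trivial v)        = [ v ]
  vertices {u} {v} (edge _)           = u ∷ v ∷ []
  vertices {u} {v} (walk _ _ w _ _ _) = u ∷ tabulate w ++ [ v ]

  TollInterval : V → V → Pred V 0ℓ
  TollInterval u v x = Σ[ p ∈ TolledWalk u v ] x ∈ vertices p

  TollClosure : List V → Pred V 0ℓ
  TollClosure S x = ∃₂ λ u v → u ∈ S × v ∈ S × TollInterval u v x

  -- A set of vertices is given by a list without repetitions, so that its
  -- cardinality is the length of the list.
  IsTollSet : List V → Set
  IsTollSet S = Unique S × (∀ x → TollClosure S x)

  -- `IsTollNumber k` says tn(F) = k: k is the minimum size of a toll set.
  IsTollNumber : ℕ → Set
  IsTollNumber k =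
    (∃[ S ] IsTollSet S × length S ≡ k) × (∀ S → IsTollSet S → k ≤ length S)

{-# OPTIONS --safe #-}

-- In G ⊠ H a closed neighbourhood is a box N[x] × N[y].  If no neighbour of
-- (x, y) has its closed neighbourhood inside the box, then neither x nor y is
-- universal, and then the complement of the box is connected: every vertex in it
-- lies on a copy of G or of H that avoids the box, and every such copy of G meets
-- every such copy of H.  Hence from any vertex p one can walk to either end, and
-- after p avoid the closed neighbourhood of the other end; cutting both walks at
-- the first neighbour of their goal and joining them at p gives a tolled walk.
-- Conversely, the neighbour of u on a tolled walk from u is followed by a vertex
-- outside N[u].
module Submission where

open import Defs
open import Data.Empty using (⊥-elim)
open import Data.Fin.Base using (Fin; zero; suc; inject₁; fromℕ)
open import Data.Fin.Properties as Fin using (all?; ¬∀⟶∃¬; fromℕ≢inject₁)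
open import Data.Fin.Relation.Unary.Top using (view; ‵fromℕ; ‵inject₁)
open import Data.List.Base using ([]; _∷_; length; tabulate)
open import Data.List.Membership.Propositional.Properties
  using (∈-++⁺ˡ; ∈-++⁻; ∈-tabulate⁺; ∈-tabulate⁻)
open import Data.List.Relation.Binary.Permutation.Propositional using (↭-refl; swap)
open import Data.List.Relation.Binary.Permutation.Propositional.Properties using (∈-resp-↭)
open import Data.List.Relation.Unary.All using ([]; _∷_)
open import Data.List.Relation.Unary.AllPairs using ([]; _∷_)
open import Data.List.Relation.Unary.Any using (here; there)
open import Data.Nat.Base using (ℕ; zero; suc; _≤_; z≤n; s≤s)
open import Data.Product.Base using (Σ-syntax; ∃-syntax; _×_; _,_; proj₁; proj₂)
open import Data.Sum.Base using (_⊎_; inj₁; inj₂; [_,_])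
open import Function.Base using (_∘_)
open import Function.Bundles using (_⇔_; Equivalence; Inverse; mk⇔)
open import Relation.Binary.Construct.Closure.ReflexiveTransitive using (Star; ε; _◅_; _◅◅_; gmap)
open import Relation.Binary.PropositionalEquality.Core using (_≡_; _≢_; refl; sym; trans; cong; subst)
open import Relation.Nullary using (¬_; yes; no; _→-dec_; _⊎-dec_; decidable-stable)
open import Relation.Unary using (Pred; Decidable; _∈_; _∉_; _⊈_)
open import Level using (0ℓ)

open Equivalence using (to; from)

-- Finite search over the vertices of a graph.

module _ (F : Graph) where
  open Graph F

  N[_]? : ∀ u → Decidable N[ u ]
  N[ u ]? v = (v ≟ u) ⊎-dec (u ~? v)

  all-or-counterexample : {P : Pred V 0ℓ} → Decidable P → (∀ v → v ∈ P) ⊎ (∃[ v ] v ∉ P)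
  all-or-counterexample {P} P? with all? (P? ∘ Inverse.from finite)
  ... | yes all = inj₁ λ v → subst P (Inverse.inverseʳ finite refl) (all (Inverse.to finite v))
  ... | no ¬all with i , ¬Pi ← ¬∀⟶∃¬ _ _ (P? ∘ Inverse.from finite) ¬all =
    inj₂ (Inverse.from finite i , ¬Pi)

  -- `P ⊈ Q` is only a negation; searching the finitely many vertices turns it into a witness, which
  -- later becomes the second vertex of a walk.
  ⊈⇒∃ : {P Q : Pred V 0ℓ} → Decidable P → Decidable Q → P ⊈ Q → ∃[ v ] v ∈ P × v ∉ Q
  ⊈⇒∃ P? Q? P⊈Q with all-or-counterexample (λ v → P? v →-dec Q? v)
  ... | inj₁ all       = ⊥-elim (P⊈Q (all _))
  ... | inj₂ (v , ¬PQ) =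
    v , decidable-stable (P? v) (λ ¬Pv → ¬PQ (⊥-elim ∘ ¬Pv)) , λ Qv → ¬PQ (λ _ → Qv)

  -- Degenerate intervals and small toll sets.

  interval-diagonal : ∀ {u x} → TollInterval F u u x → x ≡ u
  interval-diagonal (trivial _            , here x≡u) = x≡u
  interval-diagonal (edge u~u             , _)        = ⊥-elim (~-irr u~u)
  interval-diagonal (walk u≢u _ _ _ _ _   , _)        = ⊥-elim (u≢u refl)

  interval-edge : ∀ {u v x} → u ~ v → TollInterval F u v x → x ≡ u ⊎ x ≡ v
  interval-edge u~v (trivial _ , _)                  = ⊥-elim (~-irr u~v)
  interval-edge u~v (edge _ , here x≡u)              = inj₁ x≡u
  interval-edge u~v (edge _ , there (here x≡v))      = inj₂ x≡v
  interval-edge u~v (walk _ ¬u~v _ _ _ _ , _)        = ⊥-elim (¬u~v u~v)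

  closure-edge : ∀ {u v x} → u ~ v → TollClosure F (u ∷ v ∷ []) x → x ≡ u ⊎ x ≡ v
  closure-edge u~v (_ , _ , here refl , here refl , x∈) = inj₁ (interval-diagonal x∈)
  closure-edge u~v (_ , _ , here refl , there (here refl) , x∈) = interval-edge u~v x∈
  closure-edge u~v (_ , _ , there (here refl) , here refl , x∈)
    with interval-edge (~-sym u~v) x∈
  ... | inj₁ x≡v = inj₂ x≡v
  ... | inj₂ x≡u = inj₁ x≡u
  closure-edge u~v (_ , _ , there (here refl) , there (here refl) , x∈) = inj₂ (interval-diagonal x∈)

  -- The closure of an adjacent pair adds no vertex, so the graph has only the vertices `u` and `v`.
  edge-toll-set⇒complete : ∀ {u v} → u ~ v → (∀ x → TollClosure F (u ∷ v ∷ []) x) → Complete F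
  edge-toll-set⇒complete u~v cl x y x≢y with closure-edge u~v (cl x) | closure-edge u~v (cl y)
  ... | inj₁ refl | inj₁ refl = ⊥-elim (x≢y refl)
  ... | inj₁ refl | inj₂ refl = u~v
  ... | inj₂ refl | inj₁ refl = ~-sym u~v
  ... | inj₂ refl | inj₂ refl = ⊥-elim (x≢y refl)

  closure-swap : ∀ {u v x} → TollClosure F (u ∷ v ∷ []) x → TollClosure F (v ∷ u ∷ []) x
  closure-swap (a , b , a∈ , b∈ , x∈) =
    a , b , ∈-resp-↭ (swap _ _ ↭-refl) a∈ , ∈-resp-↭ (swap _ _ ↭-refl) b∈ , x∈

  2≤-toll-set : ∀ {u v} → u ≢ v → ∀ S → IsTollSet F S → 2 ≤ length S
  2≤-toll-set {u} u≢v [] (_ , cl) with _ , _ , () , _ ← cl u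
  2≤-toll-set {u} {v} u≢v (s ∷ []) (_ , cl)
    with _ , _ , here refl , here refl , u∈ ← cl u
       | _ , _ , here refl , here refl , v∈ ← cl v =
    ⊥-elim (u≢v (trans (interval-diagonal u∈) (sym (interval-diagonal v∈))))
  2≤-toll-set u≢v (_ ∷ _ ∷ _) _ = s≤s (s≤s z≤n)

  -- Tolled walks near their ends.

  module _ {u v : V} (u≢v : u ≢ v) (¬u~v : ¬ u ~ v) {m : ℕ} (w : Fin (suc m) → V)
           (w~ : ∀ i → w (inject₁ i) ~ w (suc i))
           (u~w : ∀ i → u ~ w i ⇔ i ≡ zero)
           (v~w : ∀ i → v ~ w i ⇔ i ≡ fromℕ m) where

    -- If `w i` were `u`, then either it is last and so adjacent to `v`, or its successor is a
    -- neighbour of `u` at a nonzero index.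
    inner≢source : ∀ i → w i ≢ u
    inner≢source i refl with view i
    ... | ‵fromℕ     = ¬u~v (~-sym (from (v~w _) refl))
    ... | ‵inject₁ j with () ← to (u~w _) (w~ j)

    inner≢target : ∀ i → w i ≢ v
    inner≢target zero    refl = ¬u~v (from (u~w _) refl)
    inner≢target (suc j) refl = fromℕ≢inject₁ (sym (to (v~w _) (~-sym (w~ j))))

  -- The successor of `w zero` on the walk is the witness: `v` itself when there is one inner
  -- vertex, otherwise the second inner vertex.
  source-neighbour-⊈ : ∀ {u v} → u ≢ v → ¬ u ~ v → ∀ {m} (w : Fin (suc m) → V) →
    (∀ i → w (inject₁ i) ~ w (suc i)) →
    (∀ i → u ~ w i ⇔ i ≡ zero) → (∀ i → v ~ w i ⇔ i ≡ fromℕ m) →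
    N[ w zero ] ⊈ N[ u ]
  source-neighbour-⊈ u≢v ¬u~v {zero} w w~ u~w v~w N⊆
    with N⊆ (inj₂ (~-sym (from (v~w _) refl)))
  ... | inj₁ v≡u = u≢v (sym v≡u)
  ... | inj₂ u~v = ¬u~v u~v
  source-neighbour-⊈ u≢v ¬u~v {suc m} w w~ u~w v~w N⊆ with N⊆ (inj₂ (w~ zero))
  ... | inj₁ w≡u = inner≢source u≢v ¬u~v w w~ u~w v~w _ w≡u
  ... | inj₂ u~w₁ with () ← to (u~w _) u~w₁

  target-neighbour-⊈ : ∀ {u v} → u ≢ v → ¬ u ~ v → ∀ {m} (w : Fin (suc m) → V) →
    (∀ i → w (inject₁ i) ~ w (suc i)) →
    (∀ i → u ~ w i ⇔ i ≡ zero) → (∀ i → v ~ w i ⇔ i ≡ fromℕ m) →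
    N[ w (fromℕ m) ] ⊈ N[ v ]
  target-neighbour-⊈ u≢v ¬u~v {zero} w w~ u~w v~w N⊆
    with N⊆ (inj₂ (~-sym (from (u~w _) refl)))
  ... | inj₁ u≡v = u≢v u≡v
  ... | inj₂ v~u = ¬u~v (~-sym v~u)
  target-neighbour-⊈ u≢v ¬u~v {suc m} w w~ u~w v~w N⊆
    with N⊆ (inj₂ (~-sym (w~ (fromℕ m))))
  ... | inj₁ w≡v = inner≢target u≢v ¬u~v w w~ u~w v~w _ w≡v
  ... | inj₂ v~w′ = fromℕ≢inject₁ (sym (to (v~w _) v~w′))

  -- The toll condition forces a neighbour of `u` on the walk to be its first inner vertex.
  interval-source-⊈ : ∀ {u v x} → ¬ u ~ v → u ~ x → TollInterval F u v x → N[ x ] ⊈ N[ u ]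
  interval-source-⊈ ¬u~v u~x (trivial _ , here refl) = ⊥-elim (~-irr u~x)
  interval-source-⊈ ¬u~v u~x (edge u~v , _) = ⊥-elim (¬u~v u~v)
  interval-source-⊈ ¬u~v u~x (walk _ _ _ _ _ _ , here refl) = ⊥-elim (~-irr u~x)
  interval-source-⊈ ¬u~v u~x (walk u≢v _ w w~ u~w v~w , there x∈) with ∈-++⁻ (tabulate w) x∈
  ... | inj₂ (here refl) = ⊥-elim (¬u~v u~x)
  ... | inj₁ x∈w with i , refl ← ∈-tabulate⁻ {f = w} x∈w with refl ← to (u~w i) u~x =
    source-neighbour-⊈ u≢v ¬u~v w w~ u~w v~w

  interval-target-⊈ : ∀ {u v x} → ¬ u ~ v → v ~ x → TollInterval F u v x → N[ x ] ⊈ N[ v ]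
  interval-target-⊈ ¬u~v v~x (trivial _ , here refl) = ⊥-elim (~-irr v~x)
  interval-target-⊈ ¬u~v v~x (edge u~v , _) = ⊥-elim (¬u~v u~v)
  interval-target-⊈ ¬u~v v~x (walk _ _ _ _ _ _ , here refl) = ⊥-elim (¬u~v (~-sym v~x))
  interval-target-⊈ ¬u~v v~x (walk u≢v _ w w~ u~w v~w , there x∈) with ∈-++⁻ (tabulate w) x∈
  ... | inj₂ (here refl) = ⊥-elim (~-irr v~x)
  ... | inj₁ x∈w with i , refl ← ∈-tabulate⁻ {f = w} x∈w with refl ← to (v~w i) v~x =
    target-neighbour-⊈ u≢v ¬u~v w w~ u~w v~w

  closure-neighbour-⊈ : ∀ {u v x} → ¬ u ~ v → u ~ x →
    TollClosure F (u ∷ v ∷ []) x → N[ x ] ⊈ N[ u ]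
  -- Both ends of the interval are `u`, so their non-adjacency is irreflexivity.
  closure-neighbour-⊈ ¬u~v u~x (_ , _ , here refl , here refl , x∈) =
    interval-source-⊈ ~-irr u~x x∈
  closure-neighbour-⊈ ¬u~v u~x (_ , _ , here refl , there (here refl) , x∈) =
    interval-source-⊈ ¬u~v u~x x∈
  closure-neighbour-⊈ ¬u~v u~x (_ , _ , there (here refl) , here refl , x∈) =
    interval-target-⊈ (¬u~v ∘ ~-sym) u~x x∈
  closure-neighbour-⊈ ¬u~v u~x (_ , _ , there (here refl) , there (here refl) , x∈)
    with refl ← interval-diagonal x∈ = ⊥-elim (¬u~v u~x)

  -- Tolled walks assembled from two approaches.

  _⟶[_]_ : V → V → V → Set
  a ⟶[ u ] b = a ~ b × b ∉ N[ u ]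

  -- Walks from the index vertex to the first neighbour of v, avoiding N(u)
  -- except possibly at the start.
  data Approach (u v : V) : V → Set where
    arrive : ∀ {p} → v ~ p → Approach u v p
    step   : ∀ {p q} → ¬ v ~ p → p ~ q → ¬ u ~ q → Approach u v q → Approach u v p

  approach : ∀ {u v p} → p ≢ v → Star _⟶[ u ]_ p v → Approach u v p
  approach p≢v ε = ⊥-elim (p≢v refl)
  approach {u} {v} {p} p≢v (_◅_ {j = q} (p~q , q∉) q⟶v) with v ~? p | q ≟ v
  ... | yes v~p | _        = arrive v~p
  -- The walk cannot step onto `v` from a non-neighbour of `v`, so the cut happens before `v` is
  -- reached.
  ... | no ¬v~p | yes refl = ⊥-elim (¬v~p (~-sym p~q))
  ... | no ¬v~p | no q≢v   = step ¬v~p p~q (q∉ ∘ inj₂) (approach q≢v q⟶v)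

  module _ {u v : V} where

    inner-last : ∀ {p} → Approach u v p → ℕ
    inner-last (arrive _)     = zero
    inner-last (step _ _ _ t) = suc (inner-last t)

    inner : ∀ {p} (t : Approach u v p) → Fin (suc (inner-last t)) → V
    inner {p} _              zero    = p
    inner     (step _ _ _ t) (suc i) = inner t i

    inner-~ : ∀ {p} (t : Approach u v p) i → inner t (inject₁ i) ~ inner t (suc i)
    inner-~ (step _ p~q _ _) zero    = p~q
    inner-~ (step _ _ _ t)   (suc i) = inner-~ t i

    ¬source-~-inner : ∀ {p} (t : Approach u v p) i → i ≢ zero → ¬ u ~ inner t i
    ¬source-~-inner t zero i≢0 = ⊥-elim (i≢0 refl)
    ¬source-~-inner (step _ _ ¬u~q _) (suc zero)    _ = ¬u~q
    ¬source-~-inner (step _ _ _ t)    (suc (suc i)) _ = ¬source-~-inner t (suc i) λ ()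

    target-~-inner : ∀ {p} (t : Approach u v p) i → v ~ inner t i ⇔ i ≡ fromℕ (inner-last t)
    target-~-inner t i = mk⇔ (⇒ t i) λ { refl → ⇐ t }
      where
      ⇒ : ∀ {p} (t : Approach u v p) i → v ~ inner t i → i ≡ fromℕ (inner-last t)
      ⇒ (arrive _)        zero    _   = refl
      ⇒ (step ¬v~p _ _ _) zero    v~p = ⊥-elim (¬v~p v~p)
      ⇒ (step _ _ _ t)    (suc i) v~i = cong suc (⇒ t i v~i)
      ⇐ : ∀ {p} (t : Approach u v p) → v ~ inner t (fromℕ (inner-last t))
      ⇐ (arrive v~p)   = v~p
      ⇐ (step _ _ _ t) = ⇐ t

    -- When the start is adjacent to `u`, it is the only such inner vertex, and the arrival point is
    -- the only neighbour of `v`; the approach is then exactly the inner part of a tolled walk.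
    approach-toll-interval : u ≢ v → ¬ u ~ v → ∀ {p} → u ~ p →
      (t : Approach u v p) → ∀ i → TollInterval F u v (inner t i)
    approach-toll-interval u≢v ¬u~v u~p t i =
      walk u≢v ¬u~v (inner t) (inner-~ t)
        (λ j → mk⇔ (λ u~j → decidable-stable (j Fin.≟ zero) λ j≢0 → ¬source-~-inner t j j≢0 u~j)
                   λ { refl → u~p })
        (target-~-inner t)
      , there (∈-++⁺ˡ (∈-tabulate⁺ {f = inner t} i))

  -- The approach from p to u is reversed step by step onto the approach t to v.
  joined-toll-interval : ∀ {u v p} → u ≢ v → ¬ u ~ v → Approach v u p →
    (t : Approach u v p) → ∀ i → TollInterval F u v (inner t i)
  joined-toll-interval u≢v ¬u~v (arrive u~p) t i = approach-toll-interval u≢v ¬u~v u~p t i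
  joined-toll-interval u≢v ¬u~v (step ¬u~p p~q ¬v~q r) t i =
    -- Reversing a step exchanges its two non-adjacency conditions. Prepending `q` to `t` shifts
    -- every index by one, hence `suc i`.
    joined-toll-interval u≢v ¬u~v r (step ¬v~q (~-sym p~q) ¬u~p t) (suc i)

  toll-interval : ∀ {u v p} → u ≢ v → ¬ u ~ v → p ≢ u → p ≢ v →
    Star _⟶[ v ]_ p u → Star _⟶[ u ]_ p v → TollInterval F u v p
  toll-interval u≢v ¬u~v p≢u p≢v p⟶u p⟶v =
    -- Index `zero` is `p`, where the two approaches meet.
    joined-toll-interval u≢v ¬u~v (approach p≢u p⟶u) (approach p≢v p⟶v) zero

  another-vertex : ¬ Complete F → ∀ u → ∃[ v ] v ≢ u
  another-vertex ¬complete u with all-or-counterexample (_≟ u)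
  ... | inj₂ v≢u  = v≢u
  ... | inj₁ all≡ = ⊥-elim (¬complete λ x y x≢y → ⊥-elim (x≢y (trans (all≡ x) (sym (all≡ y)))))

-- Closed neighbourhoods in the strong product.

module _ (G H : Graph) where
  private
    module G = Graph G
    module H = Graph H
    module P = Graph (G ⊠ H)

  -- Equality together with the three kinds of product edge exhausts the four ways in which each
  -- coordinate can be equal or adjacent.
  closed-box : ∀ {g h g′ h′} → (g′ , h′) ∈ P.N[ (g , h) ] ⇔ (g′ ∈ G.N[ g ] × h′ ∈ H.N[ h ])
  closed-box = mk⇔
    (λ { (inj₁ refl)                    → inj₁ refl , inj₁ refl
       ; (inj₂ (inj₁ (g~ , refl)))      → inj₂ g~ , inj₁ refl
       ; (inj₂ (inj₂ (inj₁ (refl , h~)))) → inj₁ refl , inj₂ h~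
       ; (inj₂ (inj₂ (inj₂ (g~ , h~)))) → inj₂ g~ , inj₂ h~ })
    (λ { (inj₁ refl , inj₁ refl) → inj₁ refl
       ; (inj₂ g~ , inj₁ refl)   → inj₂ (inj₁ (g~ , refl))
       ; (inj₁ refl , inj₂ h~)   → inj₂ (inj₂ (inj₁ (refl , h~)))
       ; (inj₂ g~ , inj₂ h~)     → inj₂ (inj₂ (inj₂ (g~ , h~))) })

  ⊠-complete⇒complete : H.V → Complete (G ⊠ H) → Complete G
  ⊠-complete⇒complete h complete g g′ g≢g′ with complete (g , h) (g′ , h) (g≢g′ ∘ cong proj₁)
  ... | inj₁ (g~g′ , _)        = g~g′
  ... | inj₂ (inj₁ (g≡g′ , _)) = ⊥-elim (g≢g′ g≡g′)
  ... | inj₂ (inj₂ (g~g′ , _)) = g~g′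

  module _ {x : G.V} {y : H.V} (N⊈ : ∀ p → p ∈ P.N (x , y) → P.N[ p ] ⊈ P.N[ (x , y) ]) where

    -- If `x` were universal in `G`, any other vertex `a` would give a neighbour `(a , y)` of
    -- `(x , y)` whose closed neighbourhood stays in the box: the first coordinate is unrestricted
    -- and the second is still within `H.N[ y ]`.
    left-∉ : ¬ Complete G → ∃[ a ] a ∉ G.N[ x ]
    left-∉ ¬complete with all-or-counterexample G (N[_]? G x)
    ... | inj₂ a∉ = a∉
    ... | inj₁ all∈ with a , a≢x ← another-vertex G ¬complete x with all∈ a
    ...   | inj₁ a≡x = ⊥-elim (a≢x a≡x)
    ...   | inj₂ x~a = ⊥-elim (N⊈ (a , y) (inj₁ (x~a , refl)) λ {p} p∈ →
                         from closed-box (all∈ (proj₁ p) , proj₂ (to closed-box p∈)))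

    right-∉ : ¬ Complete H → ∃[ b ] b ∉ H.N[ y ]
    right-∉ ¬complete with all-or-counterexample H (N[_]? H y)
    ... | inj₂ b∉ = b∉
    ... | inj₁ all∈ with b , b≢y ← another-vertex H ¬complete y with all∈ b
    ...   | inj₁ b≡y = ⊥-elim (b≢y b≡y)
    ...   | inj₂ y~b = ⊥-elim (N⊈ (x , b) (inj₂ (inj₁ (refl , y~b))) λ {p} p∈ →
                         from closed-box (proj₁ (to closed-box p∈) , all∈ (proj₂ p)))

  -- Walks avoiding a box.

  module _ (conG : Connected G) (conH : Connected H) {x : G.V} {y : H.V} where

    infix 3 _⟶*_
    _⟶*_ : P.V → P.V → Set
    _⟶*_ = Star (λ p q → _⟶[_]_ (G ⊠ H) p (x , y) q)

    along-G : ∀ {b} → b ∉ H.N[ y ] → ∀ a a′ → (a , b) ⟶* (a′ , b)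
    along-G {b} b∉ a a′ =
      gmap (_, b) (λ g~g′ → inj₁ (g~g′ , refl) , b∉ ∘ proj₂ ∘ to closed-box) (conG a a′)

    along-H : ∀ {a} → a ∉ G.N[ x ] → ∀ b b′ → (a , b) ⟶* (a , b′)
    along-H {a} a∉ b b′ =
      gmap (a ,_) (λ h~h′ → inj₂ (inj₁ (refl , h~h′)) , a∉ ∘ proj₁ ∘ to closed-box) (conH b b′)

    outside-coordinate : ∀ {a b} → (a , b) ∉ P.N[ (x , y) ] → a ∉ G.N[ x ] ⊎ b ∉ H.N[ y ]
    outside-coordinate {a} ∉N with N[_]? G x a
    ... | no a∉  = inj₁ a∉
    ... | yes a∈ = inj₂ λ b∈ → ∉N (from closed-box (a∈ , b∈))

    module _ {a₀ : G.V} {b₀ : H.V} (a₀∉ : a₀ ∉ G.N[ x ]) (b₀∉ : b₀ ∉ H.N[ y ]) where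

      -- The corner `(a₀ , b₀)` is a hub: the copy of `G` at `b₀` and the copy of `H` at `a₀` both
      -- miss the box, and a copy missing the box through any outside vertex crosses one of them.
      outside-connected : ∀ {p q} → p ∉ P.N[ (x , y) ] → q ∉ P.N[ (x , y) ] → p ⟶* q
      outside-connected {a , b} {a′ , b′} p∉ q∉ = to-corner ◅◅ from-corner
        where
        to-corner : (a , b) ⟶* (a₀ , b₀)
        to-corner with outside-coordinate p∉
        ... | inj₁ a∉ = along-H a∉ b b₀ ◅◅ along-G b₀∉ a a₀
        ... | inj₂ b∉ = along-G b∉ a a₀ ◅◅ along-H a₀∉ b b₀
        from-corner : (a₀ , b₀) ⟶* (a′ , b′)
        from-corner with outside-coordinate q∉
        ... | inj₁ a′∉ = along-G b₀∉ a₀ a′ ◅◅ along-H a′∉ b₀ b′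
        ... | inj₂ b′∉ = along-H a₀∉ b₀ b′ ◅◅ along-G b′∉ a₀ a′

  -- The start may lie in `P.N u`; the hypothesis `N⊈` then gives a first step that leaves
  -- `P.N[ u ]`, and the rest stays in the connected complement.
  reach-outside : Connected G → Connected H → ¬ Complete G → ¬ Complete H → ∀ {u p q} →
    (∀ p → p ∈ P.N u → P.N[ p ] ⊈ P.N[ u ]) → p ≢ u → q ∉ P.N[ u ] →
    Star (λ p q → _⟶[_]_ (G ⊠ H) p u q) p q
  reach-outside conG conH ¬comG ¬comH {u} {p} N⊈ p≢u q∉
    with left-∉ N⊈ ¬comG | right-∉ N⊈ ¬comH | u P.~? p
  ... | _ , a₀∉ | _ , b₀∉ | no ¬u~p =
    outside-connected conG conH a₀∉ b₀∉ [ p≢u , ¬u~p ] q∉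
  ... | _ , a₀∉ | _ , b₀∉ | yes u~p
    with ⊈⇒∃ (G ⊠ H) (N[_]? (G ⊠ H) p) (N[_]? (G ⊠ H) u) (N⊈ p u~p)
  ...   | _ , inj₁ refl , p∉ = ⊥-elim (p∉ (inj₂ u~p))
  ...   | _ , inj₂ p~r  , r∉ = (p~r , r∉) ◅ outside-connected conG conH a₀∉ b₀∉ r∉ q∉

corollary4p7 : (G H : Graph) →
    Connected G → Connected H → ¬ Complete G → ¬ Complete H →
    let open Graph (G ⊠ H) in
    IsTollNumber (G ⊠ H) 2 ⇔
    (Σ[ (x₁ , y₁) ∈ V ] Σ[ (x₂ , y₂) ∈ V ]
    (x₁ , y₁) ≢ (x₂ , y₂) ×
    ¬ ((x₁ , y₁) ~ (x₂ , y₂)) ×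
    (∀ ((x , y) : V) → (x , y) ∈ N (x₁ , y₁) → N[ (x , y) ] ⊈ N[ (x₁ , y₁) ]) ×
    (∀ ((x , y) : V) → (x , y) ∈ N (x₂ , y₂) → N[ (x , y) ] ⊈ N[ (x₂ , y₂) ]))
corollary4p7 G H conG conH ¬comG ¬comH = mk⇔ ⇒ ⇐
  where
  F = G ⊠ H
  open Graph F

  ⇒ : IsTollNumber F 2 →
    Σ[ u ∈ V ] Σ[ v ∈ V ] u ≢ v × ¬ u ~ v ×
      (∀ p → p ∈ N u → N[ p ] ⊈ N[ u ]) × (∀ p → p ∈ N v → N[ p ] ⊈ N[ v ])
  ⇒ ((u ∷ v ∷ [] , ((u≢v ∷ []) ∷ _ , cl) , refl) , _) =
    u , v , u≢v , ¬u~v ,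
    (λ p u~p → closure-neighbour-⊈ F ¬u~v u~p (cl p)) ,
    (λ p v~p → closure-neighbour-⊈ F (¬u~v ∘ ~-sym) v~p (closure-swap F (cl p)))
    where
    -- An adjacent toll pair would make the product complete, and with it `G`, which embeds as the
    -- copy at `proj₂ u`.
    ¬u~v : ¬ u ~ v
    ¬u~v u~v = ¬comG (⊠-complete⇒complete G H (proj₂ u) (edge-toll-set⇒complete F u~v cl))

  ⇐ : (Σ[ u ∈ V ] Σ[ v ∈ V ] u ≢ v × ¬ u ~ v ×
      (∀ p → p ∈ N u → N[ p ] ⊈ N[ u ]) × (∀ p → p ∈ N v → N[ p ] ⊈ N[ v ])) →
    IsTollNumber F 2
  ⇐ (u , v , u≢v , ¬u~v , N⊈u , N⊈v) =
    (u ∷ v ∷ [] , ((u≢v ∷ []) ∷ [] ∷ [] , closed) , refl) , 2≤-toll-set F u≢v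
    where
    closed : ∀ p → TollClosure F (u ∷ v ∷ []) p
    closed p with p ≟ u | p ≟ v
    ... | yes refl | _        = u , u , here refl , here refl , trivial u , here refl
    ... | no _     | yes refl = v , v , there (here refl) , there (here refl) , trivial v , here refl
    -- The walk to `u` has to avoid `N[ v ]` after `p`, so it uses the condition at `v`; the walk to
    -- `v` uses the condition at `u`.
    ... | no p≢u   | no p≢v   = u , v , here refl , there (here refl) ,
      toll-interval F u≢v ¬u~v p≢u p≢v
        (reach-outside G H conG conH ¬comG ¬comH N⊈v p≢v [ u≢v , ¬u~v ∘ ~-sym ])
        (reach-outside G H conG conH ¬comG ¬comH N⊈u p≢u [ u≢v ∘ sym , ¬u~v ])
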